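{- Let $n, m \in \mathbb{N}$ and let $s_1, \dots, s_n$ be positive integers with $s_i \le 2^m$ for all $i$. Let $p_1 < \dots < p_q$ be all the distinct primes dividing at least one of the $s_i$, and write $s_i = \prod_{k=1}^q p_k^{\alpha_{i,k}}$ with $\alpha_{i,k} \in \mathbb{Z}_{\ge 0}$. For each $k \in \{1,\dots,q\}$ put $T_k = \frac{1}{2}\sum_{i=1}^n \alpha_{i,k}$, and assume that $T_k$ is an integer for every $k$. Define $$\hat{s}_i = \sum_{k=1}^q \alpha_{i,k}\, k\, (nm)^{k-1} \quad (1 \le i \le n), \qquad \hat{T} = \sum_{k=1}^q T_k\, k\, (nm)^{k-1}.$$ Then there exists a set $\mathcal{C} \subseteq \{1,\dots,n\}$ with $$\prod_{i \in \mathcal{C}} s_i = \prod_{i \in \{1,\dots,n\}\setminus \mathcal{C}} s_i$$ if and only if there exists $x = (x_1,\dots,x_n) \in \{0,1\}^n$ with $\sum_{i=1}^n x_i \hat{s}_i = \hat{T}$.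
   Context: $\mathbb{N}$ denotes the positive integers. Empty products equal $1$ and empty sums equal $0$. The first condition is the Product Partition Problem (PPP) for $s_1,\dots,s_n$; the second is the Subset Sum Problem (SSP) for the numbers $\hat{s}_1,\dots,\hat{s}_n$ with target $\hat{T}$. -}

module Defs where

open import Data.Bool.Base using (if_then_else_)
open import Data.Fin.Base using (Fin; toℕ)
import Data.Fin.Base as Fin
open import Data.Fin.Subset using (Subset; ∁)
open import Data.Nat.Base using (ℕ; suc; _+_; _*_; _^_; _<_; _/_)
open import Data.Nat.Divisibility using (_∣_)
open import Data.Nat.Primality using (Prime)
open import Data.Nat.Properties using (+-0-commutativeMonoid; *-1-commutativeMonoid)
open import Data.Product.Base using (∃)
open import Data.Vec.Base using (lookup)
open import Relation.Binary.PropositionalEquality.Core using (_≡_)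

open import Algebra.Properties.CommutativeMonoid.Sum +-0-commutativeMonoid public
  using (sum)
open import Algebra.Properties.CommutativeMonoid.Sum *-1-commutativeMonoid public
  using () renaming (sum to product)

-- p₁ < … < p_q are exactly the primes dividing at least one of the sᵢ.
record IsPrimeDivisorList {n q : ℕ} (s : Fin n → ℕ) (p : Fin q → ℕ) : Set where
  field
    increasing : ∀ {k l} → k Fin.< l → p k < p l
    prime      : ∀ k → Prime (p k)
    divides    : ∀ k → ∃ λ i → p k ∣ s i
    complete   : ∀ {r} → Prime r → (∃ λ i → r ∣ s i) → ∃ λ k → p k ≡ r

productOver : ∀ {n} → Subset n → (Fin n → ℕ) → ℕ
productOver C s = product (λ i → if lookup C i then s i else 1)

PPP : ∀ {n} → (Fin n → ℕ) → Set
PPP {n} s = ∃ λ (C : Subset n) → productOver C s ≡ productOver (∁ C) s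

SSP : ∀ {n} → (Fin n → ℕ) → ℕ → Set
SSP {n} a t = ∃ λ (x : Fin n → Fin 2) → sum (λ i → toℕ (x i) * a i) ≡ t

columnSum : ∀ {n q} → (Fin n → Fin q → ℕ) → Fin q → ℕ
columnSum α k = sum (λ i → α i k)

-- `_/_` rounds down, so this is half the column sum only when that sum is even.
T : ∀ {n q} → (Fin n → Fin q → ℕ) → Fin q → ℕ
T α k = columnSum α k / 2

-- ∑ₖ cₖ · k · Bᵏ⁻¹ over k = 1, …, q; the element k : Fin q stands for the
-- index toℕ k + 1.
encode : ∀ {q} → ℕ → (Fin q → ℕ) → ℕ
encode B c = sum (λ k → c k * suc (toℕ k) * B ^ toℕ k)

ŝ : ∀ {n q} → ℕ → (Fin n → Fin q → ℕ) → Fin n → ℕ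
ŝ {n} m α i = encode (n * m) (α i)

T̂ : ∀ {n q} → ℕ → (Fin n → Fin q → ℕ) → ℕ
T̂ {n} m α = encode (n * m) (T α)

{-# OPTIONS --safe #-}
module Submission where

-- Write (χ · α)ₖ for the exponent of pₖ in the product of the sᵢ selected by the
-- 0/1 vector χ.  By unique factorisation C solves the product partition problem iff
-- χ_C · α and χ_∁C · α agree; as their sum is 2T, this says χ_C · α = T.  It remains
-- to see that encode B, with B = nm, separates χ_C · α from T.  As pₖ ≥ 2, each row of
-- α has sum at most m, so the entries of χ_C · α, and those of T, have total at most B.
-- On such digit vectors encode B is injective: individual terms k cₖ may exceed B,
-- but the first q terms add up to at most q B^q < (q + 1) B^q, so the last position
-- in which two vectors differ decides the comparison.

open import Defs
open import Data.Bool.Base using (Bool; true; false; not; if_then_else_)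
open import Data.Fin.Base using (Fin; zero; suc; toℕ; fromℕ; inject₁)
import Data.Fin.Base as Fin
open import Data.Fin.Properties as Fin using (toℕ-inject₁; toℕ-fromℕ; toℕ≤pred[n]; 2↔Bool)
open import Data.Fin.Relation.Unary.Top using (view; ‵fromℕ; ‵inject₁)
open import Data.Fin.Subset using (Subset; ∁)
open import Data.Nat.Base
open import Data.Nat.Divisibility using (_∣_; _∤_; ∣1⇒≡1; m∣m*n; ∣m⇒∣m*n)
open import Data.Nat.DivMod using (m/n*n≡m; m/n≤m)
open import Data.Nat.Primality
  using (Prime; euclidsLemma; prime⇒irreducible; prime⇒nonZero; prime⇒nonTrivial; ¬prime[1])
open import Data.Nat.Properties
open import Data.Product.Base using (_×_; _,_; proj₁; proj₂)
open import Data.Sum.Base using (inj₁; inj₂)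
open import Data.Vec.Base using (lookup; tabulate)
open import Data.Vec.Properties using (lookup-map; lookup∘tabulate)
open import Function.Base using (_∘_; case_of_)
open import Function.Bundles using (_⇔_; mk⇔; Equivalence; Inverse)
open import Function.Definitions using (Injective)
open import Relation.Binary.Definitions using (tri<; tri≈; tri>)
open import Relation.Binary.PropositionalEquality
  using (_≡_; _≗_; refl; sym; trans; cong; cong₂; subst; module ≡-Reasoning)
open import Relation.Nullary.Negation using (contradiction)

open import Algebra.Properties.Semiring.Sum +-*-semiring
  using (sum-cong-≗; sum-init-last; ∑-comm; ∑-distrib-+; *-distribˡ-sum; *-distribʳ-sum)
open import Algebra.Properties.CommutativeMonoid.Sum *-1-commutativeMonoid
  using () renaming (sum-cong-≗ to product-cong-≗; sum-replicate-zero to product-replicate-one; ∑-comm to ∏-comm)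

private
  variable
    n q : ℕ

-- Finite sums and products

sum-mono : {f g : Fin n → ℕ} → (∀ i → f i ≤ g i) → sum f ≤ sum g
sum-mono {zero}  f≤g = z≤n
sum-mono {suc n} f≤g = +-mono-≤ (f≤g zero) (sum-mono (f≤g ∘ suc))

product-mono : {f g : Fin n → ℕ} → (∀ i → f i ≤ g i) → product f ≤ product g
product-mono {zero}  f≤g = ≤-refl
product-mono {suc n} f≤g = *-mono-≤ (f≤g zero) (product-mono (f≤g ∘ suc))

sum-bound : ∀ {m} {f : Fin n → ℕ} → (∀ i → f i ≤ m) → sum f ≤ n * m
sum-bound {zero}  f≤m = z≤n
sum-bound {suc n} f≤m = +-mono-≤ (f≤m zero) (sum-bound (f≤m ∘ suc))

^-sum : ∀ b (f : Fin n → ℕ) → b ^ sum f ≡ product (λ i → b ^ f i)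
^-sum {zero}  b f = refl
^-sum {suc n} b f = trans (^-distribˡ-+-* b (f zero) _) (cong (b ^ f zero *_) (^-sum b (f ∘ suc)))

-- Unique factorisation

prime∣^⇒∣ : ∀ {r} m n → Prime r → r ∣ m ^ n → r ∣ m
prime∣^⇒∣ m zero    pr r∣1 = contradiction (subst Prime (∣1⇒≡1 r∣1) pr) ¬prime[1]
prime∣^⇒∣ m (suc n) pr r∣  with euclidsLemma m (m ^ n) pr r∣
... | inj₁ r∣m  = r∣m
... | inj₂ r∣mⁿ = prime∣^⇒∣ m n pr r∣mⁿ

prime∤product : ∀ {r} → Prime r → (f : Fin n → ℕ) → (∀ i → r ∤ f i) → r ∤ product f
prime∤product {zero}  pr f r∤f r∣1 = ¬prime[1] (subst Prime (∣1⇒≡1 r∣1) pr)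
prime∤product {suc n} pr f r∤f r∣  with euclidsLemma (f zero) _ pr r∣
... | inj₁ r∣f₀ = r∤f zero r∣f₀
... | inj₂ r∣∏  = prime∤product pr (f ∘ suc) (r∤f ∘ suc) r∣∏

prime∣prime⇒≡ : ∀ {r p} → Prime r → Prime p → r ∣ p → r ≡ p
prime∣prime⇒≡ pr pp r∣p with prime⇒irreducible pp r∣p
... | inj₁ refl = contradiction pr ¬prime[1]
... | inj₂ r≡p  = r≡p

-- Cancel one factor `p` at a time. Were one exponent to run out first, the remaining `p` on the
-- other side would divide `u` or `v`.
^-*-injective : ∀ {p u v} .{{_ : NonZero p}} a b → p ∤ u → p ∤ v →
                p ^ a * u ≡ p ^ b * v → a ≡ b × u ≡ v
^-*-injective {u = u} {v} zero zero _ _ eq =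
  refl , trans (sym (*-identityˡ u)) (trans eq (*-identityˡ v))
^-*-injective {p} {u} {v} zero (suc b) p∤u _ eq =
  contradiction (subst (p ∣_) (trans (sym eq) (*-identityˡ u)) (∣m⇒∣m*n v (m∣m*n (p ^ b)))) p∤u
^-*-injective {p} {u} {v} (suc a) zero _ p∤v eq =
  contradiction (subst (p ∣_) (trans eq (*-identityˡ v)) (∣m⇒∣m*n u (m∣m*n (p ^ a)))) p∤v
^-*-injective {p} {u} {v} (suc a) (suc b) p∤u p∤v eq
  with refl , u≡v ← ^-*-injective a b p∤u p∤v
         (*-cancelˡ-≡ _ _ p (trans (sym (*-assoc p (p ^ a) u)) (trans eq (*-assoc p (p ^ b) v))))
  = refl , u≡v

productOfPowers-injective : (p : Fin q → ℕ) → (∀ k → Prime (p k)) → Injective _≡_ _≡_ p →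
                            (a b : Fin q → ℕ) →
                            product (λ k → p k ^ a k) ≡ product (λ k → p k ^ b k) → a ≗ b
productOfPowers-injective {suc q} p primes inj a b eq = λ where
    zero    → proj₁ split
    (suc k) → productOfPowers-injective (p ∘ suc) (primes ∘ suc) (Fin.suc-injective ∘ inj)
                (a ∘ suc) (b ∘ suc) (proj₂ split) k
  where
  -- If the first prime divided a later power, it would equal that later prime, and injectivity
  -- would give `zero ≡ suc k`.
  p₀∤tail : (e : Fin q → ℕ) → p zero ∤ product (λ k → p (suc k) ^ e k)
  p₀∤tail e = prime∤product (primes zero) _ λ k p₀∣ →
    case inj (prime∣prime⇒≡ (primes zero) (primes (suc k))
                (prime∣^⇒∣ (p (suc k)) (e k) (primes zero) p₀∣)) of λ ()

  split = ^-*-injective {{prime⇒nonZero (primes zero)}} (a zero) (b zero)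
            (p₀∤tail (a ∘ suc)) (p₀∤tail (b ∘ suc)) eq

increasing⇒injective : {p : Fin q → ℕ} → (∀ {k l} → k Fin.< l → p k < p l) → Injective _≡_ _≡_ p
increasing⇒injective incr {k} {l} pk≡pl with Fin.<-cmp k l
... | tri< k<l _ _ = contradiction pk≡pl (<⇒≢ (incr k<l))
... | tri≈ _ k≡l _ = k≡l
... | tri> _ _ l<k = contradiction (sym pk≡pl) (<⇒≢ (incr l<k))

-- Replacing every prime by 2 only shrinks the product, so a total above `m` would force it past
-- `2 ^ m`.
sumOfExponents≤ : ∀ {m} {p : Fin q → ℕ} → (∀ k → Prime (p k)) → (a : Fin q → ℕ) →
                  product (λ k → p k ^ a k) ≤ 2 ^ m → sum a ≤ m
sumOfExponents≤ {m = m} {p} primes a ∏≤2^m = ≮⇒≥ λ m<∑a → <⇒≱ (^-monoʳ-< 2 (s≤s (s≤s z≤n)) m<∑a) (begin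
  2 ^ sum a                    ≡⟨ ^-sum 2 a ⟩
  product (λ k → 2 ^ a k)      ≤⟨ product-mono (λ k → ^-monoˡ-≤ (a k) (nonTrivial⇒n>1 (p k) {{prime⇒nonTrivial (primes k)}})) ⟩
  product (λ k → p k ^ a k)    ≤⟨ ∏≤2^m ⟩
  2 ^ m                        ∎)
  where open ≤-Reasoning

-- The encoding and its injectivity on vectors of bounded total

encode-cong : ∀ B {c d : Fin q → ℕ} → c ≗ d → encode B c ≡ encode B d
encode-cong B c≗d = sum-cong-≗ λ k → cong (λ e → e * suc (toℕ k) * B ^ toℕ k) (c≗d k)

-- `sum` recurses from the first position, but comparison starts at the most significant one. Since
-- `inject₁` preserves `toℕ`, the prefix keeps its weights and is again an `encode`.
encode-init-last : ∀ B (c : Fin (suc q) → ℕ) →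
                   encode B c ≡ encode B (c ∘ inject₁) + c (fromℕ q) * (suc q * B ^ q)
encode-init-last {q} B c = trans (sum-init-last (λ k → c k * suc (toℕ k) * B ^ toℕ k)) (cong₂ _+_
  (sum-cong-≗ λ k → cong (λ j → c (inject₁ k) * suc j * B ^ j) (toℕ-inject₁ k))
  (trans (cong (λ j → c (fromℕ q) * suc j * B ^ j) (toℕ-fromℕ q)) (*-assoc (c (fromℕ q)) (suc q) (B ^ q))))

-- Every weight is at most the last one, and the bound on the total of `c` then costs a single
-- further factor `B`. A bound on each digit separately would be too weak.
encode-≤ : ∀ B .{{_ : NonZero B}} (c : Fin q → ℕ) → sum c ≤ B → encode B c ≤ q * B ^ q
encode-≤ {zero}  B c _ = z≤n
encode-≤ {suc q} B c ∑c≤B = begin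
  encode B c                              ≤⟨ sum-mono (λ k → *-mono-≤ (*-monoʳ-≤ (c k) (s≤s (toℕ≤pred[n] k)))
                                                                      (^-monoʳ-≤ B (toℕ≤pred[n] k))) ⟩
  sum (λ k → c k * suc q * B ^ q)         ≡⟨ sum-cong-≗ (λ k → *-assoc (c k) (suc q) (B ^ q)) ⟩
  sum (λ k → c k * (suc q * B ^ q))       ≡⟨ *-distribʳ-sum (suc q * B ^ q) c ⟨
  sum c * (suc q * B ^ q)                 ≤⟨ *-monoˡ-≤ (suc q * B ^ q) ∑c≤B ⟩
  B * (suc q * B ^ q)                     ≡⟨ x∙yz≈y∙xz B (suc q) (B ^ q) ⟩
  suc q * B ^ suc q                       ∎
  where
  open ≤-Reasoning
  open import Algebra.Properties.CommutativeSemigroup *-commutativeSemigroup using (x∙yz≈y∙xz)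

sum-init≤ : (c : Fin (suc q) → ℕ) → sum (c ∘ inject₁) ≤ sum c
sum-init≤ c = ≤-trans (m≤m+n _ _) (≤-reflexive (sym (sum-init-last c)))

encode-<-last : ∀ B .{{_ : NonZero B}} (c d : Fin (suc q) → ℕ) → sum c ≤ B →
                c (fromℕ q) < d (fromℕ q) → encode B c < encode B d
encode-<-last {q} B c d ∑c≤B c<d = begin-strict
  encode B c                                   ≡⟨ encode-init-last B c ⟩
  encode B (c ∘ inject₁) + c (fromℕ q) * w     ≤⟨ +-monoˡ-≤ _ (encode-≤ B (c ∘ inject₁) (≤-trans (sum-init≤ c) ∑c≤B)) ⟩
  -- All lower positions together weigh less than one unit `w` of the last, because `B ^ q` is
  -- positive.
  q * B ^ q + c (fromℕ q) * w                  <⟨ +-monoˡ-< _ (*-monoˡ-< (B ^ q) {{m^n≢0 B q}} (n<1+n q)) ⟩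
  suc (c (fromℕ q)) * w                        ≤⟨ *-monoˡ-≤ w c<d ⟩
  d (fromℕ q) * w                              ≤⟨ m≤n+m _ _ ⟩
  encode B (d ∘ inject₁) + d (fromℕ q) * w     ≡⟨ encode-init-last B d ⟨
  encode B d                                   ∎
  where
  open ≤-Reasoning
  w = suc q * B ^ q

encode-injective : ∀ B .{{_ : NonZero B}} (c d : Fin q → ℕ) → sum c ≤ B → sum d ≤ B →
                   encode B c ≡ encode B d → c ≗ d
encode-injective {suc q} B c d ∑c≤B ∑d≤B eq with <-cmp (c (fromℕ q)) (d (fromℕ q))
... | tri< c<d _ _ = contradiction eq (<⇒≢ (encode-<-last B c d ∑c≤B c<d))
... | tri> _ _ d<c = contradiction (sym eq) (<⇒≢ (encode-<-last B d c ∑d≤B d<c))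
... | tri≈ _ cₗ≡dₗ _ = pointwise
  where
  -- Equal last digits cancel, and the prefixes inherit the bound on the total, so the induction
  -- continues.
  init-eq : encode B (c ∘ inject₁) ≡ encode B (d ∘ inject₁)
  init-eq = +-cancelʳ-≡ (c (fromℕ q) * (suc q * B ^ q)) _ _ (begin
    encode B (c ∘ inject₁) + c (fromℕ q) * (suc q * B ^ q)  ≡⟨ encode-init-last B c ⟨
    encode B c                                              ≡⟨ eq ⟩
    encode B d                                              ≡⟨ encode-init-last B d ⟩
    encode B (d ∘ inject₁) + d (fromℕ q) * (suc q * B ^ q)  ≡⟨ cong (λ e → _ + e * (suc q * B ^ q)) cₗ≡dₗ ⟨
    encode B (d ∘ inject₁) + c (fromℕ q) * (suc q * B ^ q)  ∎)
    where open ≡-Reasoning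

  pointwise : c ≗ d
  pointwise k with view k
  ... | ‵fromℕ     = cₗ≡dₗ
  ... | ‵inject₁ j = encode-injective B (c ∘ inject₁) (d ∘ inject₁)
                       (≤-trans (sum-init≤ c) ∑c≤B) (≤-trans (sum-init≤ d) ∑d≤B) init-eq j

-- Selecting rows of the exponent matrix

infixl 7 _·_

_·_ : (Fin n → ℕ) → (Fin n → Fin q → ℕ) → Fin q → ℕ
(x · α) k = sum (λ i → x i * α i k)

-- Linearity of `encode`, by interchanging the two sums. It turns a subset sum of the encoded rows
-- into the encoding of one exponent vector.
encode-· : ∀ B (x : Fin n → ℕ) (α : Fin n → Fin q → ℕ) →
           sum (λ i → x i * encode B (α i)) ≡ encode B (x · α)
encode-· B x α = begin
  sum (λ i → x i * encode B (α i))                         ≡⟨ sum-cong-≗ (λ i → *-distribˡ-sum (x i) (λ k → α i k * w₁ k * w₂ k)) ⟩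
  sum (λ i → sum (λ k → x i * (α i k * w₁ k * w₂ k)))      ≡⟨ ∑-comm (λ i k → x i * (α i k * w₁ k * w₂ k)) ⟩
  sum (λ k → sum (λ i → x i * (α i k * w₁ k * w₂ k)))      ≡⟨ sum-cong-≗ (λ k → sum-cong-≗ (λ i → reassoc i k)) ⟩
  sum (λ k → sum (λ i → x i * α i k * (w₁ k * w₂ k)))      ≡⟨ sum-cong-≗ (λ k → *-distribʳ-sum (w₁ k * w₂ k) (λ i → x i * α i k)) ⟨
  sum (λ k → (x · α) k * (w₁ k * w₂ k))                    ≡⟨ sum-cong-≗ (λ k → *-assoc ((x · α) k) (w₁ k) (w₂ k)) ⟨
  encode B (x · α)                                         ∎
  where
  open ≡-Reasoning
  w₁ w₂ : Fin _ → ℕ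
  w₁ k = suc (toℕ k)
  w₂ k = B ^ toℕ k

  reassoc : ∀ i k → x i * (α i k * w₁ k * w₂ k) ≡ x i * α i k * (w₁ k * w₂ k)
  reassoc i k = trans (cong (x i *_) (*-assoc (α i k) (w₁ k) (w₂ k)))
                      (sym (*-assoc (x i) (α i k) (w₁ k * w₂ k)))

bit : Bool → Fin 2
bit = Inverse.from 2↔Bool

-- Routed through `Fin 2` so that the sum in `SSP` for `bit ∘ lookup C` is definitionally one over
-- `χ C`.
χ : Subset n → Fin n → ℕ
χ C i = toℕ (bit (lookup C i))

χ-tabulate : (x : Fin n → Fin 2) → χ (tabulate (Inverse.to 2↔Bool ∘ x)) ≗ toℕ ∘ x
χ-tabulate x i = cong toℕ (trans (cong bit (lookup∘tabulate _ i)) (Inverse.strictlyInverseʳ 2↔Bool (x i)))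

χ-∁ : (C : Subset n) → ∀ i → χ C i + χ (∁ C) i ≡ 1
χ-∁ C i = trans (cong (λ b → χ C i + toℕ (bit b)) (lookup-map i not C)) (bit-not (lookup C i))
  where
  bit-not : ∀ b → toℕ (bit b) + toℕ (bit (not b)) ≡ 1
  bit-not true  = refl
  bit-not false = refl

χ·-∁ : (C : Subset n) (α : Fin n → Fin q → ℕ) → ∀ k → (χ C · α) k + (χ (∁ C) · α) k ≡ columnSum α k
χ·-∁ C α k = trans (sym (∑-distrib-+ (λ i → χ C i * α i k) (λ i → χ (∁ C) i * α i k)))
  (sum-cong-≗ λ i → begin
    χ C i * α i k + χ (∁ C) i * α i k   ≡⟨ *-distribʳ-+ (α i k) (χ C i) (χ (∁ C) i) ⟨
    (χ C i + χ (∁ C) i) * α i k         ≡⟨ cong (_* α i k) (χ-∁ C i) ⟩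
    1 * α i k                           ≡⟨ *-identityˡ (α i k) ⟩
    α i k                               ∎)
  where open ≡-Reasoning

-- Multiplying the exponents by 0 turns an excluded factor into 1, so the conditional moves into the
-- exponents; then the two products are interchanged.
productOver-factorised : {s : Fin n → ℕ} (p : Fin q → ℕ) (α : Fin n → Fin q → ℕ) →
                         (∀ i → s i ≡ product (λ k → p k ^ α i k)) → (C : Subset n) →
                         productOver C s ≡ product (λ k → p k ^ (χ C · α) k)
productOver-factorised {q = q} {s} p α s≡ C = begin
  productOver C s                                          ≡⟨ product-cong-≗ (λ i → select (lookup C i) i) ⟩
  product (λ i → product (λ k → p k ^ (χ C i * α i k)))    ≡⟨ ∏-comm (λ i k → p k ^ (χ C i * α i k)) ⟩
  product (λ k → product (λ i → p k ^ (χ C i * α i k)))    ≡⟨ product-cong-≗ (λ k → ^-sum (p k) (λ i → χ C i * α i k)) ⟨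
  product (λ k → p k ^ (χ C · α) k)                        ∎
  where
  open ≡-Reasoning
  select : ∀ b i → (if b then s i else 1) ≡ product (λ k → p k ^ (toℕ (bit b) * α i k))
  select true  i = trans (s≡ i) (product-cong-≗ λ k → cong (p k ^_) (sym (*-identityˡ (α i k))))
  select false i = sym (product-replicate-one q)

-- Evenness makes the floor division exact, so both sides say that twice `c` is `e`.
half-unique : ∀ {c d e} → c + d ≡ e → 2 ∣ e → c ≡ d ⇔ c ≡ e / 2
half-unique {c} {d} {e} c+d≡e 2∣e = mk⇔
  (λ { refl → *-cancelʳ-≡ c (e / 2) 2 (trans (double c) (trans c+d≡e e≡)) })
  (λ { refl → sym (+-cancelˡ-≡ c d c (trans c+d≡e (trans e≡ (double c)))) })
  where
  e≡ : e ≡ e / 2 * 2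
  e≡ = sym (m/n*n≡m 2∣e)

  double : ∀ x → x * 2 ≡ x + x
  double x = trans (*-comm x 2) (cong (x +_) (+-identityʳ x))

theorem2p7 : (n m : ℕ) → 0 < n → 0 < m →
    (s : Fin n → ℕ) → (∀ i → 0 < s i) → (∀ i → s i ≤ 2 ^ m) →
    (q : ℕ) (p : Fin q → ℕ) → IsPrimeDivisorList s p →
    (α : Fin n → Fin q → ℕ) → (∀ i → s i ≡ product (λ k → p k ^ α i k)) →
    (∀ k → 2 ∣ columnSum α k) →
    PPP s ⇔ SSP (ŝ m α) (T̂ m α)
theorem2p7 n m 0<n 0<m s _ s≤2^m q p isList α s≡ even = mk⇔ ppp⇒ssp ssp⇒ppp
  where
  open IsPrimeDivisorList isList using (increasing; prime)
  open Equivalence using (to; from)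

  instance
    n*m≢0 : NonZero (n * m)
    n*m≢0 = m*n≢0 n m {{>-nonZero 0<n}} {{>-nonZero 0<m}}

  half : ∀ C k → (χ C · α) k ≡ (χ (∁ C) · α) k ⇔ (χ C · α) k ≡ T α k
  half C k = half-unique (χ·-∁ C α k) (even k)

  -- Counted by rows instead of columns, the entries of `α` form `n` rows of total at most `m` each.
  ∑columnSum≤ : sum (columnSum α) ≤ n * m
  ∑columnSum≤ = ≤-trans (≤-reflexive (sym (∑-comm α)))
    (sum-bound λ i → sumOfExponents≤ prime (α i) (subst (_≤ 2 ^ m) (s≡ i) (s≤2^m i)))

  ppp⇒ssp : PPP s → SSP (ŝ m α) (T̂ m α)
  ppp⇒ssp (C , eq) = bit ∘ lookup C , trans (encode-· (n * m) (χ C) α) (encode-cong (n * m) χC·α≗T)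
    where
    χC·α≗T : χ C · α ≗ T α
    χC·α≗T k = to (half C k)
      (productOfPowers-injective p prime (increasing⇒injective increasing) (χ C · α) (χ (∁ C) · α)
      (trans (sym (productOver-factorised p α s≡ C)) (trans eq (productOver-factorised p α s≡ (∁ C)))) k)

  ssp⇒ppp : SSP (ŝ m α) (T̂ m α) → PPP s
  ssp⇒ppp (x , eq) = C , (begin
      productOver C s                            ≡⟨ productOver-factorised p α s≡ C ⟩
      product (λ k → p k ^ (χ C · α) k)          ≡⟨ product-cong-≗ (λ k → cong (p k ^_) (from (half C k) (χC·α≗T k))) ⟩
      product (λ k → p k ^ (χ (∁ C) · α) k)      ≡⟨ productOver-factorised p α s≡ (∁ C) ⟨
      productOver (∁ C) s                        ∎)
    where
    open ≡-Reasoning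

    C : Subset n
    C = tabulate (Inverse.to 2↔Bool ∘ x)

    encode-eq : encode (n * m) (χ C · α) ≡ encode (n * m) (T α)
    encode-eq = trans (sym (encode-· (n * m) (χ C) α))
      (trans (sum-cong-≗ λ i → cong (_* ŝ m α i) (χ-tabulate x i)) eq)

    χC·α≗T : χ C · α ≗ T α
    χC·α≗T = encode-injective (n * m) (χ C · α) (T α)
      -- Both vectors lie entrywise below the column sums, which gives the two bounds on totals.
      (≤-trans (sum-mono λ k → ≤-trans (m≤m+n _ _) (≤-reflexive (χ·-∁ C α k))) ∑columnSum≤)
      (≤-trans (sum-mono λ k → m/n≤m (columnSum α k) 2) ∑columnSum≤)
      encode-eq
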